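{- Let $\mathbb A$ be a combinatorial atlas of dimension $d$ that satisfies the inheritance property (Inh) and the pullback property (Pull), and let $v\in\Omega^+$ be a non-sink regular vertex of its digraph $\Gamma$. Suppose every out-neighbor of $v$ is hyperbolic. Then $v$ is also hyperbolic.
   Context: **Combinatorial atlas.** Let $\mathcal P=(\Omega,\prec)$ be a locally finite poset of bounded height and let $\Gamma=(\Omega,\Theta)$ be the acyclic digraph given by its Hasse diagram. Let $\Omega^0$ be the set of maximal elements of $\mathcal P$ (sinks of $\Gamma$) and $\Omega^+=\Omega\setminus\Omega^0$ the non-sink vertices. A combinatorial atlas $\mathbb A$ of dimension $d$ is $\Gamma$ with the following structure: each $v\in\Omega$ is associated with a pair $(M_v,h_v)$, where $M_v$ is a nonnegative symmetric $d\times d$ real matrix and $h_v\in\mathbb R_{\ge0}^d$; each $v\in\Omega^+$ has outdegree $d$, with outgoing edges labeled by $i\in[d]=\{1,\dots,d\}$, the edge labeled $i$ being $(v,v^{\langle i\rangle})$; and each such edge is associated with a linear map $T_v^{\langle i\rangle}:\mathbb R^d\to\mathbb R^d$. For fixed $v\in\Omega^+$ write $M=M_v$, $h=h_v=(h_1,\dots,h_d)$, $T^{\langle i\rangle}=T_v^{\langle i\rangle}$, $M^{\langle i\rangle}=M_{v^{\langle i\rangle}}$. The support of a symmetric matrix is $\mathrm{supp}(M)=\{i\in[d]:M_{ij}\ne0\text{ for some }j\}$. $\langle\cdot,\cdot\rangle$ is the standard inner product on $\mathbb R^d$. **Hyperbolic.** A vertex $v\in\Omega$ is hyperbolic if $M=M_v$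 satisfies $\langle x,My\rangle^2\ge\langle x,Mx\rangle\langle y,My\rangle$ for all $x,y\in\mathbb R^d$ with $\langle y,My\rangle>0$. **(Inh)** For every $v\in\Omega^+$: $(Mx)_i=\langle T^{\langle i\rangle}x,\ M^{\langle i\rangle}T^{\langle i\rangle}h\rangle$ for every $i\in\mathrm{supp}(M)$ and $x\in\mathbb R^d$. **(Pull)** For every $v\in\Omega^+$: $\sum_{i\in\mathrm{supp}(M)}h_i\,\langle T^{\langle i\rangle}x,\ M^{\langle i\rangle}T^{\langle i\rangle}x\rangle\ \ge\ \langle x,Mx\rangle$ for every $x\in\mathbb R^d$. **Regular.** A vertex $v\in\Omega^+$ is regular if $M_v$ restricted to its support is an irreducible matrix (not similar via a permutation to a block upper triangular matrix with more than one block of positive size), and $h_v$ restricted to $\mathrm{supp}(M_v)$ is strictly positive. -}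

module Defs where

open import Algebra.Bundles using (CommutativeRing)
open import Algebra.Structures using (IsCommutativeRing)
open import Data.Bool.Base using (if_then_else_)
open import Data.Fin.Base using (Fin) renaming (_<_ to _<ᶠ_; _≤_ to _≤ᶠ_)
open import Data.Fin.Permutation using (Permutation′; _⟨$⟩ʳ_)
open import Data.Fin.Properties using (any?)
open import Data.List.Base using (List; length; lookup; filter; allFin)
open import Data.List.Membership.Propositional using (_∈_)
open import Data.List.Relation.Unary.Linked using (Linked)
open import Data.Nat.Base as ℕ using (ℕ)
open import Data.Product.Base using (Σ-syntax; ∃-syntax; _×_)
open import Data.Vec.Functional using (Vector)
open import Function.Bundles using (_⇔_)
open import Function.Definitions using (Injective; StrictlySurjective)
open import Level using (Level; _⊔_; suc; 0ℓ)
open import Relation.Binary.Core using (Rel)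
open import Relation.Binary.Structures using (IsDecTotalOrder; IsStrictPartialOrder)
open import Relation.Binary.PropositionalEquality.Core using (_≡_)
open import Relation.Nullary using (¬_; ¬?; does)
open import Relation.Unary using (Decidable)

import Algebra.Properties.CommutativeMonoid.Sum as Sum
import Data.Vec.Functional.Relation.Binary.Equality.Setoid as VecEq
import Relation.Binary.Construct.NonStrictToStrict as ToStrict
import Relation.Binary.Construct.StrictToNonStrict as ToNonStrict

-- The library has no real numbers.  They are given here by the axioms that
-- characterise them up to isomorphism: a Dedekind-complete, totally ordered
-- field.  As in classical mathematics, the order is decidable.
record RealNumbers : Set₁ where
  infix  4 _≈_ _≤_ _<_
  infixl 6 _+_
  infixl 7 _*_
  infix  8 -_
  field
    Carrier           : Set
    _≈_ _≤_           : Rel Carrier 0ℓ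
    _+_ _*_           : Carrier → Carrier → Carrier
    -_                : Carrier → Carrier
    0# 1#             : Carrier
    isCommutativeRing : IsCommutativeRing _≈_ _+_ _*_ -_ 0# 1#
    0≉1               : ¬ (0# ≈ 1#)
    inverse           : ∀ x → ¬ (x ≈ 0#) → ∃[ y ] x * y ≈ 1#
    isDecTotalOrder   : IsDecTotalOrder _≈_ _≤_
    +-monoʳ-≤         : ∀ x {y z} → y ≤ z → x + y ≤ x + z
    *-nonNeg          : ∀ {x y} → 0# ≤ x → 0# ≤ y → 0# ≤ x * y

  UpperBound : (Carrier → Set) → Carrier → Set
  UpperBound P u = ∀ x → P x → x ≤ u

  field
    complete : ∀ (P : Carrier → Set) → (∃[ x ] P x) → (∃[ u ] UpperBound P u) →
               ∃[ s ] (UpperBound P s × (∀ u → UpperBound P u → s ≤ u))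

  _<_ : Rel Carrier 0ℓ
  _<_ = ToStrict._<_ _≈_ _≤_

  commutativeRing : CommutativeRing 0ℓ 0ℓ
  commutativeRing = record { isCommutativeRing = isCommutativeRing }

  open IsDecTotalOrder isDecTotalOrder public using (_≟_; _≤?_)

module _ {a r} {Ω : Set a} (_≺_ : Rel Ω r) where

  open ToNonStrict _≡_ _≺_ using () renaming (_≤_ to _≼_)

  LocallyFinite : Set (a ⊔ r)
  LocallyFinite = ∀ u w → Σ[ xs ∈ List Ω ] (∀ x → x ∈ xs ⇔ (u ≼ x × x ≼ w))

  BoundedHeight : Set (a ⊔ r)
  BoundedHeight = Σ[ H ∈ ℕ ] (∀ (chain : List Ω) → Linked _≺_ chain → length chain ℕ.≤ H)

  -- The edges of the Hasse diagram point upwards.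
  Edge : Rel Ω (a ⊔ r)
  Edge v w = v ≺ w × (∀ u → ¬ (v ≺ u × u ≺ w))

  Sink : Ω → Set (a ⊔ r)
  Sink v = ∀ w → ¬ (v ≺ w)

  -- As a negation this is definitionally proof-irrelevant, so data indexed by
  -- a proof of NonSink v depend on v only.
  NonSink : Ω → Set (a ⊔ r)
  NonSink v = ¬ Sink v

module CombinatorialAtlas (ℝ : RealNumbers) where

  open RealNumbers ℝ renaming (Carrier to Real)
  open CommutativeRing commutativeRing using (setoid; +-commutativeMonoid)
  open Sum +-commutativeMonoid using (sum)
  open VecEq setoid using (_≋_)

  private variable
    d n : ℕ

  Vec : ℕ → Set
  Vec = Vector Real

  Matrix : ℕ → Set
  Matrix n = Fin n → Fin n → Real

  ⟨_,_⟩ : Vec d → Vec d → Real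
  ⟨ x , y ⟩ = sum (λ i → x i * y i)

  infixr 8 _·_
  _·_ : Matrix d → Vec d → Vec d
  (M · x) i = sum (λ j → M i j * x j)

  record IsLinear (T : Vec d → Vec d) : Set where
    field
      cong   : ∀ {x y} → x ≋ y → T x ≋ T y
      +-homo : ∀ x y → T (λ i → x i + y i) ≋ (λ i → T x i + T y i)
      *-homo : ∀ c x → T (λ i → c * x i) ≋ (λ i → c * T x i)

  Symmetric : Matrix d → Set
  Symmetric M = ∀ i j → M i j ≈ M j i

  HyperbolicMatrix : Matrix d → Set
  HyperbolicMatrix M = ∀ x y → 0# < ⟨ y , M · y ⟩ →
    ⟨ x , M · x ⟩ * ⟨ y , M · y ⟩ ≤ ⟨ x , M · y ⟩ * ⟨ x , M · y ⟩

  Supp : Matrix d → Fin d → Set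
  Supp M i = ∃[ j ] ¬ (M i j ≈ 0#)

  supp? : (M : Matrix d) → Decidable (Supp M)
  supp? M i = any? (λ j → ¬? (M i j ≟ 0#))

  sumSupp : Matrix d → (Fin d → Real) → Real
  sumSupp M f = sum (λ i → if does (supp? M i) then f i else 0#)

  suppList : Matrix d → List (Fin d)
  suppList M = filter (supp? M) (allFin _)

  restrictToSupp : (M : Matrix d) → Matrix (length (suppList M))
  restrictToSupp M i j = M (lookup (suppList M) i) (lookup (suppList M) j)

  -- Row and column i lie in the block number (block i).  Monotonicity makes the
  -- blocks consecutive, surjectivity makes each of the m blocks nonempty.
  record BlockUpperTriangular (m : ℕ) (A : Matrix n) : Set where
    field
      block      : Fin n → Fin m
      monotone   : ∀ {i j} → i ≤ᶠ j → block i ≤ᶠ block j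
      surjective : StrictlySurjective _≡_ block
      zeroBelow  : ∀ {i j} → block j <ᶠ block i → A i j ≈ 0#

  -- Similarity via a permutation π is simultaneous reindexing of rows and columns.
  Irreducible : Matrix n → Set
  Irreducible {n} A = ¬ (Σ[ π ∈ Permutation′ n ] ∃[ m ]
    (1 ℕ.< m × BlockUpperTriangular m (λ i j → A (π ⟨$⟩ʳ i) (π ⟨$⟩ʳ j))))

  record Atlas (d : ℕ) (a r : Level) : Set (suc (a ⊔ r)) where
    field
      Ω                    : Set a
      _≺_                  : Rel Ω r
      isStrictPartialOrder : IsStrictPartialOrder _≡_ _≺_
      locallyFinite        : LocallyFinite _≺_
      boundedHeight        : BoundedHeight _≺_

      M           : Ω → Matrix d
      h           : Ω → Vec d
      M-nonNeg    : ∀ v i j → 0# ≤ M v i j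
      M-symmetric : ∀ v → Symmetric (M v)
      h-nonNeg    : ∀ v i → 0# ≤ h v i

      -- next v v⁺ i is the head v⟨i⟩ of the edge labelled i.  Injectivity and
      -- surjectivity onto the out-neighbours say that v has outdegree d.
      next            : ∀ v → NonSink _≺_ v → Fin d → Ω
      next-edge       : ∀ v v⁺ i → Edge _≺_ v (next v v⁺ i)
      next-injective  : ∀ v v⁺ → Injective _≡_ _≡_ (next v v⁺)
      next-surjective : ∀ v v⁺ w → Edge _≺_ v w → ∃[ i ] next v v⁺ i ≡ w

      T        : ∀ v → NonSink _≺_ v → Fin d → Vec d → Vec d
      T-linear : ∀ v v⁺ i → IsLinear (T v v⁺ i)

    Hyperbolic : Ω → Set
    Hyperbolic v = HyperbolicMatrix (M v)

    Inheritance : Set (a ⊔ r)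
    Inheritance = ∀ v (v⁺ : NonSink _≺_ v) i → Supp (M v) i → ∀ x →
      (M v · x) i ≈ ⟨ T v v⁺ i x , M (next v v⁺ i) · T v v⁺ i (h v) ⟩

    Pullback : Set (a ⊔ r)
    Pullback = ∀ v (v⁺ : NonSink _≺_ v) x →
      ⟨ x , M v · x ⟩ ≤
      sumSupp (M v) (λ i → h v i * ⟨ T v v⁺ i x , M (next v v⁺ i) · T v v⁺ i x ⟩)

    Regular : Ω → Set
    Regular v = Irreducible (restrictToSupp (M v)) × (∀ i → Supp (M v) i → 0# < h v i)

{-# OPTIONS --safe #-}
module Submission where

-- Write D for the diagonal matrix with entries (M h)_i / h_i.  For each i in the
-- support, hyperbolicity of v⟨i⟩ at the pair (T⟨i⟩ z , T⟨i⟩ h) and (Inh) bound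
-- ⟨T⟨i⟩ z , M⟨i⟩ T⟨i⟩ z⟩ (M h)_i by (M z)_i², so (Pull) yields
-- ⟨z , M z⟩ ≤ ⟨x , D x⟩ whenever M z = D x.  The Laplacian L = D - M is positive
-- semidefinite, because
--   2 ⟨y , L y⟩ = Σ M_ij h_i h_j (y_i / h_i - y_j / h_j)²,
-- and irreducibility makes y / h constant on the support for y in its kernel.
-- Hence L z = D u is solvable for every u with ⟨u , M h⟩ = 0, and x = z - u then
-- gives ⟨u , M u⟩ ≤ 0.  A symmetric form that is nonpositive on the hyperplane
-- ⟨u , M h⟩ = 0 is hyperbolic.  Solvability comes from the Fredholm alternative,
-- which takes the place of the spectral theorem.

open import Algebra.Bundles using (CommutativeRing)
open import Algebra.Solver.Ring.AlmostCommutativeRing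
  using (fromCommutativeRing; _-Raw-AlmostCommutative⟶_)
open import Data.Bool.Base using (if_then_else_)
open import Data.Fin.Base using (Fin; zero; suc; fromℕ; toℕ) renaming (_≤_ to _≤ᶠ_; _<_ to _<ᶠ_)
open import Data.Fin.Patterns using (0F; 1F)
open import Data.Fin.Permutation using (Permutation′; _⟨$⟩ʳ_; _⟨$⟩ˡ_; inverseʳ; id; lift₀; insert)
open import Data.Fin.Properties using (any?; ¬Fin0; ≤fromℕ; punchOut-mono-≤)
  renaming (_≟_ to _≟ᶠ_; ≤-antisym to ≤ᶠ-antisym)
open import Data.List.Base using (lookup; length)
open import Data.List.Membership.Propositional.Properties using (∈-filter⁺; ∈-allFin)
open import Data.List.Relation.Unary.Any using (index)
open import Data.List.Relation.Unary.Any.Properties using (lookup-index)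
open import Data.Maybe.Base using (Maybe; just; nothing)
open import Data.Nat.Base as ℕ using (ℕ; z≤n; s≤s)
import Data.Nat.Properties as ℕ
open import Data.Integer.Base as ℤ using (ℤ; +_; -[1+_]; 0ℤ; 1ℤ)
import Data.Integer.Properties as ℤ
open import Data.Product.Base using (Σ-syntax; ∃-syntax; _×_; _,_; proj₁; proj₂)
open import Data.Sum.Base using (_⊎_; inj₁; inj₂)
open import Data.Vec.Functional using (_∷_)
open import Function.Base using (_∘_)
open import Level using (Level; 0ℓ)
open import Relation.Binary.Bundles using (Poset)
open import Relation.Binary.PropositionalEquality.Core as ≡ using (_≡_)
open import Relation.Binary.Structures using (IsDecTotalOrder)
open import Relation.Nullary using (¬_; ¬?; yes; no; does; contradiction; decidable-stable)
open import Defs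

import Algebra.Properties.Ring as RingProperties
import Algebra.Properties.Semiring.Mult.TCOptimised as Mult
import Algebra.Properties.Semiring.Sum as Sum
import Algebra.Solver.Ring as RingSolver
import Relation.Binary.Reasoning.PartialOrder as ≤-Reasoning
import Relation.Binary.Reasoning.Setoid as ≈-Reasoning

-- The ring solver over the coefficients ℤ: with coefficients in an abstract
-- carrier it could not recognise 1# - 1# as zero.
module IntegerRingSolver (R : CommutativeRing 0ℓ 0ℓ) where

  open CommutativeRing R
  open RingProperties ring
  open Mult semiring using (1+×; ×1-homo-*; ×-homo-+) renaming (_×_ to _×ᴿ_)
  open ≈-Reasoning setoid

  ⟦_⟧ᶻ : ℤ → Carrier
  ⟦ + n ⟧ᶻ      = n ×ᴿ 1#
  ⟦ -[1+ n ] ⟧ᶻ = - (ℕ.suc n ×ᴿ 1#)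

  ⟦⟧-neg : ∀ i → ⟦ ℤ.- i ⟧ᶻ ≈ - ⟦ i ⟧ᶻ
  ⟦⟧-neg (+ ℕ.zero)  = sym -0#≈0#
  ⟦⟧-neg (+ ℕ.suc n) = refl
  ⟦⟧-neg -[1+ n ]    = sym (-‿involutive _)

  ⟦⟧-⊖ : ∀ m n → ⟦ m ℤ.⊖ n ⟧ᶻ ≈ m ×ᴿ 1# - n ×ᴿ 1#
  ⟦⟧-⊖ m         ℕ.zero    = sym (trans (+-congˡ -0#≈0#) (+-identityʳ _))
  ⟦⟧-⊖ ℕ.zero    (ℕ.suc n) = sym (+-identityˡ _)
  ⟦⟧-⊖ (ℕ.suc m) (ℕ.suc n) = begin
    ⟦ ℕ.suc m ℤ.⊖ ℕ.suc n ⟧ᶻ          ≡⟨ ≡.cong ⟦_⟧ᶻ (ℤ.[1+m]⊖[1+n]≡m⊖n m n) ⟩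
    ⟦ m ℤ.⊖ n ⟧ᶻ                      ≈⟨ ⟦⟧-⊖ m n ⟩
    a - b                             ≈⟨ +-congʳ (+-identityʳ a) ⟨
    a + 0# - b                        ≈⟨ +-congʳ (+-congˡ (-‿inverseʳ 1#)) ⟨
    a + (1# - 1#) - b                 ≈⟨ +-congʳ (+-assoc a 1# (- 1#)) ⟨
    a + 1# - 1# - b                   ≈⟨ +-assoc (a + 1#) (- 1#) (- b) ⟩
    a + 1# + (- 1# - b)               ≈⟨ +-cong (+-comm a 1#) (-‿+-comm 1# b) ⟩
    1# + a - (1# + b)                 ≈⟨ +-cong (1+× m 1#) (-‿cong (1+× n 1#)) ⟨
    ℕ.suc m ×ᴿ 1# - ℕ.suc n ×ᴿ 1#     ∎
    where
    a = m ×ᴿ 1#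
    b = n ×ᴿ 1#

  ⟦⟧-+ : ∀ i j → ⟦ i ℤ.+ j ⟧ᶻ ≈ ⟦ i ⟧ᶻ + ⟦ j ⟧ᶻ
  ⟦⟧-+ (+ m)    (+ n)    = ×-homo-+ 1# m n
  ⟦⟧-+ (+ m)    -[1+ n ] = ⟦⟧-⊖ m (ℕ.suc n)
  ⟦⟧-+ -[1+ m ] (+ n)    = trans (⟦⟧-⊖ n (ℕ.suc m)) (+-comm _ _)
  ⟦⟧-+ -[1+ m ] -[1+ n ] = begin
    - (ℕ.suc (ℕ.suc (m ℕ.+ n)) ×ᴿ 1#)      ≡⟨ ≡.cong (λ k → - (ℕ.suc k ×ᴿ 1#)) (ℕ.+-suc m n) ⟨
    - ((ℕ.suc m ℕ.+ ℕ.suc n) ×ᴿ 1#)        ≈⟨ -‿cong (×-homo-+ 1# (ℕ.suc m) (ℕ.suc n)) ⟩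
    - (ℕ.suc m ×ᴿ 1# + ℕ.suc n ×ᴿ 1#)      ≈⟨ -‿+-comm _ _ ⟨
    ⟦ -[1+ m ] ⟧ᶻ + ⟦ -[1+ n ] ⟧ᶻ          ∎

  ⟦⟧-*-pos : ∀ m n → ⟦ + m ℤ.* + n ⟧ᶻ ≈ ⟦ + m ⟧ᶻ * ⟦ + n ⟧ᶻ
  ⟦⟧-*-pos m n = trans (reflexive (≡.cong ⟦_⟧ᶻ (≡.sym (ℤ.pos-* m n)))) (×1-homo-* m n)

  ⟦⟧-*-posˡ : ∀ m j → ⟦ + m ℤ.* j ⟧ᶻ ≈ ⟦ + m ⟧ᶻ * ⟦ j ⟧ᶻ
  ⟦⟧-*-posˡ m (+ n)    = ⟦⟧-*-pos m n
  ⟦⟧-*-posˡ m -[1+ n ] = begin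
    ⟦ + m ℤ.* -[1+ n ] ⟧ᶻ              ≡⟨ ≡.cong ⟦_⟧ᶻ (ℤ.neg-distribʳ-* (+ m) (+ ℕ.suc n)) ⟨
    ⟦ ℤ.- (+ m ℤ.* + ℕ.suc n) ⟧ᶻ       ≈⟨ ⟦⟧-neg (+ m ℤ.* + ℕ.suc n) ⟩
    - ⟦ + m ℤ.* + ℕ.suc n ⟧ᶻ           ≈⟨ -‿cong (⟦⟧-*-pos m (ℕ.suc n)) ⟩
    - (⟦ + m ⟧ᶻ * ⟦ + ℕ.suc n ⟧ᶻ)      ≈⟨ -‿distribʳ-* _ _ ⟩
    ⟦ + m ⟧ᶻ * ⟦ -[1+ n ] ⟧ᶻ           ∎

  ⟦⟧-* : ∀ i j → ⟦ i ℤ.* j ⟧ᶻ ≈ ⟦ i ⟧ᶻ * ⟦ j ⟧ᶻ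
  ⟦⟧-* (+ m)    j = ⟦⟧-*-posˡ m j
  ⟦⟧-* -[1+ m ] j = begin
    ⟦ -[1+ m ] ℤ.* j ⟧ᶻ                ≡⟨ ≡.cong ⟦_⟧ᶻ (ℤ.neg-distribˡ-* (+ ℕ.suc m) j) ⟨
    ⟦ ℤ.- (+ ℕ.suc m ℤ.* j) ⟧ᶻ         ≈⟨ ⟦⟧-neg (+ ℕ.suc m ℤ.* j) ⟩
    - ⟦ + ℕ.suc m ℤ.* j ⟧ᶻ             ≈⟨ -‿cong (⟦⟧-*-posˡ (ℕ.suc m) j) ⟩
    - (⟦ + ℕ.suc m ⟧ᶻ * ⟦ j ⟧ᶻ)        ≈⟨ -‿distribˡ-* _ _ ⟩
    ⟦ -[1+ m ] ⟧ᶻ * ⟦ j ⟧ᶻ             ∎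

  homomorphism : ℤ.+-*-rawRing -Raw-AlmostCommutative⟶ fromCommutativeRing R
  homomorphism = record
    { ⟦_⟧    = ⟦_⟧ᶻ
    ; +-homo = ⟦⟧-+
    ; *-homo = ⟦⟧-*
    ; -‿homo = ⟦⟧-neg
    ; 0-homo = refl
    ; 1-homo = refl
    }

  _coeff≟_ : ∀ i j → Maybe (⟦ i ⟧ᶻ ≈ ⟦ j ⟧ᶻ)
  i coeff≟ j with i ℤ.≟ j
  ... | yes i≡j = just (reflexive (≡.cong ⟦_⟧ᶻ i≡j))
  ... | no _    = nothing

  open RingSolver ℤ.+-*-rawRing (fromCommutativeRing R) homomorphism _coeff≟_ public

sorting-permutation : ∀ {n} (c : Fin n → Fin 2) →
  Σ[ π ∈ Permutation′ n ] (∀ {i j} → i ≤ᶠ j → c (π ⟨$⟩ʳ i) ≤ᶠ c (π ⟨$⟩ʳ j))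
sorting-permutation {ℕ.zero} c = id , λ {i} _ → contradiction i ¬Fin0
sorting-permutation {ℕ.suc n} c with sorting-permutation (c ∘ suc) | c zero in c₀
... | π , mono | 0F = lift₀ π , lifted
  where
  lifted : ∀ {i j} → i ≤ᶠ j → c (lift₀ π ⟨$⟩ʳ i) ≤ᶠ c (lift₀ π ⟨$⟩ʳ j)
  lifted {zero}          _         rewrite c₀ = z≤n
  lifted {suc i} {suc j} (s≤s i≤j) = mono i≤j
... | π , mono | 1F = insert (fromℕ n) zero π , inserted
  where
  inserted : ∀ {i j} → i ≤ᶠ j →
    c (insert (fromℕ n) zero π ⟨$⟩ʳ i) ≤ᶠ c (insert (fromℕ n) zero π ⟨$⟩ʳ j)
  inserted {i} {j} i≤j with fromℕ n ≟ᶠ i | fromℕ n ≟ᶠ j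
  ... | _          | yes _   rewrite c₀ = ≤fromℕ (c _)
  ... | yes ≡.refl | no n≢j  = contradiction (≤ᶠ-antisym i≤j (≤fromℕ j)) n≢j
  ... | no n≢i     | no n≢j  = mono (punchOut-mono-≤ n≢i n≢j i≤j)

module _ (ℝ : RealNumbers) where

  open CombinatorialAtlas ℝ
  open RealNumbers ℝ renaming (Carrier to Real)
  open CommutativeRing commutativeRing
    hiding (Carrier; _≈_; _+_; _*_; -_; 0#; 1#; isCommutativeRing; zero)
  open RingProperties ring using (-0#≈0#)
  open Sum semiring
  open IntegerRingSolver commutativeRing using (solve; _:=_; _:+_; _:*_; _:-_; :-_; con)
  open IsDecTotalOrder isDecTotalOrder using (isPartialOrder; total; antisym)
    renaming (refl to ≤-refl; trans to ≤-trans
             ; ≤-respˡ-≈ to ≤-respˡ; ≤-respʳ-≈ to ≤-respʳ)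

  poset : Poset 0ℓ 0ℓ 0ℓ
  poset = record { isPartialOrder = isPartialOrder }

  module ≈R = ≈-Reasoning setoid
  module ≤R = ≤-Reasoning poset

  -- Ordered field

  +-mono-≤ : ∀ {w x y z} → w ≤ x → y ≤ z → w + y ≤ x + z
  +-mono-≤ {w} {x} {y} {z} w≤x y≤z = begin
    w + y ≤⟨ +-monoʳ-≤ w y≤z ⟩
    w + z ≈⟨ +-comm w z ⟩
    z + w ≤⟨ +-monoʳ-≤ z w≤x ⟩
    z + x ≈⟨ +-comm z x ⟩
    x + z ∎
    where open ≤R

  +-cancelˡ-≤ : ∀ x {y z} → x + y ≤ x + z → y ≤ z
  +-cancelˡ-≤ x {y} {z} le = begin
    y             ≈⟨ solve 2 (λ x y → y := :- x :+ (x :+ y)) refl x y ⟩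
    - x + (x + y) ≤⟨ +-monoʳ-≤ (- x) le ⟩
    - x + (x + z) ≈⟨ solve 2 (λ x z → z := :- x :+ (x :+ z)) refl x z ⟨
    z             ∎
    where open ≤R

  x≤y⇒0≤y-x : ∀ {x y} → x ≤ y → 0# ≤ y - x
  x≤y⇒0≤y-x {x} {y} x≤y = ≤-respˡ (-‿inverseˡ x) (≤-respʳ (+-comm (- x) y) (+-monoʳ-≤ (- x) x≤y))

  0≤y-x⇒x≤y : ∀ {x y} → 0# ≤ y - x → x ≤ y
  0≤y-x⇒x≤y {x} {y} 0≤ = +-cancelˡ-≤ (- x) (≤-respˡ (sym (-‿inverseˡ x)) (≤-respʳ (+-comm y (- x)) 0≤))

  *-monoʳ-≤ : ∀ {x y z} → 0# ≤ x → y ≤ z → x * y ≤ x * z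
  *-monoʳ-≤ {x} {y} {z} 0≤x y≤z = 0≤y-x⇒x≤y (≤-respʳ
    (solve 3 (λ x y z → x :* (z :- y) := x :* z :- x :* y) refl x y z)
    (*-nonNeg 0≤x (x≤y⇒0≤y-x y≤z)))

  square-nonNeg : ∀ x → 0# ≤ x * x
  square-nonNeg x with total 0# x
  ... | inj₁ 0≤x = *-nonNeg 0≤x 0≤x
  ... | inj₂ x≤0 = ≤-respʳ (solve 1 (λ x → :- x :* :- x := x :* x) refl x) (*-nonNeg 0≤-x 0≤-x)
    where
    0≤-x : 0# ≤ - x
    0≤-x = ≤-respʳ (+-identityˡ (- x)) (x≤y⇒0≤y-x x≤0)

  recip : Real → Real
  recip x with x ≟ 0#
  ... | yes _  = 0#
  ... | no x≉0 = proj₁ (inverse x x≉0)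

  *-recip : ∀ {x} → ¬ (x ≈ 0#) → x * recip x ≈ 1#
  *-recip {x} x≉0 with x ≟ 0#
  ... | yes x≈0 = contradiction x≈0 x≉0
  ... | no x≉0  = proj₂ (inverse x x≉0)

  recip-nonNeg : ∀ {x} → 0# ≤ x → 0# ≤ recip x
  recip-nonNeg {x} 0≤x with x ≟ 0#
  ... | yes _  = ≤-refl
  ... | no x≉0 = let (y , xy≈1) = inverse x x≉0 in
    ≤-respʳ (trans (solve 2 (λ x y → (y :* y) :* x := y :* (x :* y)) refl x y)
                   (trans (*-congˡ xy≈1) (*-identityʳ y)))
            (*-nonNeg (square-nonNeg y) 0≤x)

  pos⇒≉0 : ∀ {x} → 0# < x → ¬ (x ≈ 0#)
  pos⇒≉0 (_ , 0≉x) x≈0 = 0≉x (sym x≈0)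

  *-cancelˡ-≤ : ∀ {x y z} → 0# < x → x * y ≤ x * z → y ≤ z
  *-cancelˡ-≤ {x} {y} {z} 0<x le =
    ≤-respˡ (cancel y) (≤-respʳ (cancel z) (*-monoʳ-≤ (recip-nonNeg (proj₁ 0<x)) le))
    where
    cancel : ∀ w → recip x * (x * w) ≈ w
    cancel w = trans (solve 3 (λ r x w → r :* (x :* w) := (x :* r) :* w) refl (recip x) x w)
      (trans (*-congʳ (*-recip (pos⇒≉0 0<x))) (*-identityˡ w))

  *-≉0 : ∀ {x y} → ¬ (x ≈ 0#) → ¬ (y ≈ 0#) → ¬ (x * y ≈ 0#)
  *-≉0 {x} {y} x≉0 y≉0 xy≈0 = y≉0 (begin
    y                 ≈⟨ *-identityˡ y ⟨
    1# * y            ≈⟨ *-congʳ (*-recip x≉0) ⟨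
    x * recip x * y   ≈⟨ solve 3 (λ x r y → x :* r :* y := r :* (x :* y)) refl x (recip x) y ⟩
    recip x * (x * y) ≈⟨ *-congˡ xy≈0 ⟩
    recip x * 0#      ≈⟨ zeroʳ _ ⟩
    0#                ∎)
    where open ≈R

  *-pos : ∀ {x y} → 0# < x → 0# < y → 0# < x * y
  *-pos 0<x 0<y = *-nonNeg (proj₁ 0<x) (proj₁ 0<y) , λ 0≈xy → *-≉0 (pos⇒≉0 0<x) (pos⇒≉0 0<y) (sym 0≈xy)

  square≈0⇒≈0 : ∀ {x} → x * x ≈ 0# → x ≈ 0#
  square≈0⇒≈0 {x} xx≈0 = decidable-stable (x ≟ 0#) λ x≉0 → *-≉0 x≉0 x≉0 xx≈0

  <-≤-trans : ∀ {x y z} → x < y → y ≤ z → x < z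
  <-≤-trans (x≤y , x≉y) y≤z =
    ≤-trans x≤y y≤z , λ x≈z → x≉y (antisym x≤y (≤-respʳ (sym x≈z) y≤z))

  +-double-cancel-≤ : ∀ {x y} → x + x ≤ y + y → x ≤ y
  +-double-cancel-≤ {x} {y} xx≤yy with total x y
  ... | inj₁ x≤y = x≤y
  ... | inj₂ y≤x = +-cancelˡ-≤ x (≤-trans xx≤yy (+-mono-≤ y≤x ≤-refl))

  <-respʳ : ∀ {x y z} → y ≈ z → x < y → x < z
  <-respʳ y≈z (x≤y , x≉y) = ≤-respʳ y≈z x≤y , λ x≈z → x≉y (trans x≈z (sym y≈z))

  -- Finite sums

  sum-nonNeg : ∀ {n} {f : Vec n} → (∀ i → 0# ≤ f i) → 0# ≤ sum f
  sum-nonNeg {ℕ.zero}  0≤f = ≤-refl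
  sum-nonNeg {ℕ.suc n} 0≤f = ≤-respˡ (+-identityˡ 0#) (+-mono-≤ (0≤f zero) (sum-nonNeg (0≤f ∘ suc)))

  sum-mono-≤ : ∀ {n} {f g : Vec n} → (∀ i → f i ≤ g i) → sum f ≤ sum g
  sum-mono-≤ {ℕ.zero}  f≤g = ≤-refl
  sum-mono-≤ {ℕ.suc n} f≤g = +-mono-≤ (f≤g zero) (sum-mono-≤ (f≤g ∘ suc))

  sum-zero : ∀ {n} {f : Vec n} → (∀ i → f i ≈ 0#) → sum f ≈ 0#
  sum-zero {n} f≈0 = trans (sum-cong-≋ f≈0) (sum-replicate-zero n)

  term≤sum : ∀ {n} {f : Vec n} → (∀ i → 0# ≤ f i) → ∀ i → f i ≤ sum f
  term≤sum {f = f} 0≤f zero    = ≤-respˡ (+-identityʳ _) (+-monoʳ-≤ (f zero) (sum-nonNeg (0≤f ∘ suc)))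
  term≤sum {f = f} 0≤f (suc i) = ≤-respˡ (+-identityˡ _) (+-mono-≤ (0≤f zero) (term≤sum (0≤f ∘ suc) i))

  sum≈0⇒term≈0 : ∀ {n} {f : Vec n} → (∀ i → 0# ≤ f i) → sum f ≈ 0# → ∀ i → f i ≈ 0#
  sum≈0⇒term≈0 0≤f sum≈0 i = antisym (≤-respʳ sum≈0 (term≤sum 0≤f i)) (0≤f i)

  -- Vectors and bilinear forms

  infixl 6 _⊕_∙_
  _⊕_∙_ : ∀ {n} → Vec n → Real → Vec n → Vec n
  (x ⊕ c ∙ y) i = x i + c * y i

  ⟨⟩-congʳ : ∀ {n} (x : Vec n) {y z : Vec n} → (∀ i → y i ≈ z i) → ⟨ x , y ⟩ ≈ ⟨ x , z ⟩
  ⟨⟩-congʳ x y≈z = sum-cong-≋ (λ i → *-congˡ (y≈z i))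

  ⟨⟩-comm : ∀ {n} (x y : Vec n) → ⟨ x , y ⟩ ≈ ⟨ y , x ⟩
  ⟨⟩-comm x y = sum-cong-≋ (λ i → *-comm (x i) (y i))

  ⟨⟩-⊕ˡ : ∀ {n} (x : Vec n) c y w → ⟨ x ⊕ c ∙ y , w ⟩ ≈ ⟨ x , w ⟩ + c * ⟨ y , w ⟩
  ⟨⟩-⊕ˡ x c y w = begin
    ⟨ x ⊕ c ∙ y , w ⟩                             ≈⟨ sum-cong-≋ (λ i → solve 4
      (λ x c y w → (x :+ c :* y) :* w := x :* w :+ c :* (y :* w)) refl (x i) c (y i) (w i)) ⟩
    sum (λ i → x i * w i + c * (y i * w i))       ≈⟨ ∑-distrib-+ (λ i → x i * w i) _ ⟩
    ⟨ x , w ⟩ + sum (λ i → c * (y i * w i))       ≈⟨ +-congˡ (*-distribˡ-sum c (λ i → y i * w i)) ⟨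
    ⟨ x , w ⟩ + c * ⟨ y , w ⟩                     ∎
    where open ≈R

  ⟨⟩-⊕ʳ : ∀ {n} (w : Vec n) x c y → ⟨ w , x ⊕ c ∙ y ⟩ ≈ ⟨ w , x ⟩ + c * ⟨ w , y ⟩
  ⟨⟩-⊕ʳ w x c y = trans (⟨⟩-comm w (x ⊕ c ∙ y))
    (trans (⟨⟩-⊕ˡ x c y w) (+-cong (⟨⟩-comm x w) (*-congˡ (⟨⟩-comm y w))))

  ⟨⟩-transpose : ∀ {m n} (x : Vec m) (A : Fin m → Fin n → Real) (y : Vec n) →
    ⟨ x , (λ i → ⟨ A i , y ⟩) ⟩ ≈ ⟨ (λ j → ⟨ x , (λ i → A i j) ⟩) , y ⟩
  ⟨⟩-transpose x A y = begin
    ⟨ x , (λ i → ⟨ A i , y ⟩) ⟩                      ≈⟨ sum-cong-≋ (λ i → *-distribˡ-sum (x i) (λ j → A i j * y j)) ⟩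
    sum (λ i → sum (λ j → x i * (A i j * y j)))      ≈⟨ ∑-comm (λ i j → x i * (A i j * y j)) ⟩
    sum (λ j → sum (λ i → x i * (A i j * y j)))      ≈⟨ sum-cong-≋ (λ j → sum-cong-≋ (λ i → *-assoc (x i) (A i j) (y j))) ⟨
    sum (λ j → sum (λ i → x i * A i j * y j))        ≈⟨ sum-cong-≋ (λ j → *-distribʳ-sum (y j) (λ i → x i * A i j)) ⟨
    ⟨ (λ j → ⟨ x , (λ i → A i j) ⟩) , y ⟩            ∎
    where open ≈R

  form-⊕ʳ : ∀ {n} (M : Matrix n) w x c y →
    ⟨ w , M · (x ⊕ c ∙ y) ⟩ ≈ ⟨ w , M · x ⟩ + c * ⟨ w , M · y ⟩
  form-⊕ʳ M w x c y = trans (⟨⟩-congʳ w (λ i → ⟨⟩-⊕ʳ (M i) x c y)) (⟨⟩-⊕ʳ w (M · x) c (M · y))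

  form-sym : ∀ {n} {M : Matrix n} → Symmetric M → ∀ x y → ⟨ x , M · y ⟩ ≈ ⟨ y , M · x ⟩
  form-sym {M = M} M-sym x y = begin
    ⟨ x , M · y ⟩                              ≈⟨ ⟨⟩-transpose x M y ⟩
    ⟨ (λ j → ⟨ x , (λ i → M i j) ⟩) , y ⟩      ≈⟨ ⟨⟩-comm _ y ⟩
    ⟨ y , (λ j → ⟨ x , (λ i → M i j) ⟩) ⟩      ≈⟨ ⟨⟩-congʳ y (λ j → trans (⟨⟩-comm x _)
                                                    (sum-cong-≋ (λ i → *-congʳ (M-sym i j)))) ⟩
    ⟨ y , M · x ⟩                              ∎
    where open ≈R

  quadratic-⊕ : ∀ {n} {M : Matrix n} → Symmetric M → ∀ x c y →
    ⟨ x ⊕ c ∙ y , M · (x ⊕ c ∙ y) ⟩ ≈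
    ⟨ x , M · x ⟩ + (c * ⟨ x , M · y ⟩ + c * ⟨ x , M · y ⟩) + c * c * ⟨ y , M · y ⟩
  quadratic-⊕ {M = M} M-sym x c y = begin
    ⟨ x ⊕ c ∙ y , M · (x ⊕ c ∙ y) ⟩
      ≈⟨ form-⊕ʳ M (x ⊕ c ∙ y) x c y ⟩
    ⟨ x ⊕ c ∙ y , M · x ⟩ + c * ⟨ x ⊕ c ∙ y , M · y ⟩
      ≈⟨ +-cong (⟨⟩-⊕ˡ x c y (M · x)) (*-congˡ (⟨⟩-⊕ˡ x c y (M · y))) ⟩
    X + c * ⟨ y , M · x ⟩ + c * (P + c * Y)
      ≈⟨ +-congʳ (+-congˡ (*-congˡ (form-sym M-sym y x))) ⟩
    X + c * P + c * (P + c * Y)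
      ≈⟨ solve 4 (λ X c P Y → X :+ c :* P :+ c :* (P :+ c :* Y) :=
                              X :+ (c :* P :+ c :* P) :+ c :* c :* Y) refl X c P Y ⟩
    X + (c * P + c * P) + c * c * Y ∎
    where
    open ≈R
    X = ⟨ x , M · x ⟩
    P = ⟨ x , M · y ⟩
    Y = ⟨ y , M · y ⟩

  δ : ∀ {n} → Fin n → Fin n → Real
  δ zero    zero    = 1#
  δ zero    (suc j) = 0#
  δ (suc i) zero    = 0#
  δ (suc i) (suc j) = δ i j

  ⟨δ,⟩ : ∀ {n} (i : Fin n) x → ⟨ δ i , x ⟩ ≈ x i
  ⟨δ,⟩ zero    x = trans (+-cong (*-identityˡ _) (sum-zero (λ i → zeroˡ (x (suc i))))) (+-identityʳ _)
  ⟨δ,⟩ (suc i) x = trans (+-cong (zeroˡ _) (⟨δ,⟩ i (x ∘ suc))) (+-identityˡ _)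

  fredholm : ∀ {m n} (A : Fin m → Fin n → Real) (b : Vec m) →
    (Σ[ z ∈ Vec n ] (∀ i → ⟨ A i , z ⟩ ≈ b i)) ⊎
    (Σ[ y ∈ Vec m ] ((∀ j → ⟨ y , (λ i → A i j) ⟩ ≈ 0#) × ¬ (⟨ y , b ⟩ ≈ 0#)))
  fredholm {n = ℕ.zero} A b with any? (λ i → ¬? (b i ≟ 0#))
  ... | yes (i , bᵢ≉0) = inj₂ (δ i , (λ ()) , λ eq → bᵢ≉0 (trans (sym (⟨δ,⟩ i b)) eq))
  ... | no b≈0         = inj₁ ((λ ()) , λ i →
    sym (decidable-stable (b i ≟ 0#) (λ bᵢ≉0 → b≈0 (i , bᵢ≉0))))
  fredholm {m} {ℕ.suc n} A b = step (fredholm A′ b)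
    where
    Solution = Σ[ z ∈ Vec (ℕ.suc n) ] (∀ i → ⟨ A i , z ⟩ ≈ b i)
    Obstruction = Σ[ y ∈ Vec m ] ((∀ j → ⟨ y , (λ i → A i j) ⟩ ≈ 0#) × ¬ (⟨ y , b ⟩ ≈ 0#))

    A₀ : Vec m
    A₀ i = A i zero

    A′ : Fin m → Fin n → Real
    A′ i j = A i (suc j)

    module _ (y : Vec m) (yA′≈0 : ∀ j → ⟨ y , (λ i → A′ i j) ⟩ ≈ 0#) (yA₀≉0 : ¬ (⟨ y , A₀ ⟩ ≈ 0#)) where

      α = recip ⟨ y , A₀ ⟩
      z₀ = α * ⟨ y , b ⟩
      b′ = b ⊕ (- z₀) ∙ A₀

      eliminate : (Σ[ z ∈ Vec n ] (∀ i → ⟨ A′ i , z ⟩ ≈ b′ i)) ⊎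
        (Σ[ y′ ∈ Vec m ] ((∀ j → ⟨ y′ , (λ i → A′ i j) ⟩ ≈ 0#) × ¬ (⟨ y′ , b′ ⟩ ≈ 0#))) →
        Solution ⊎ Obstruction
      eliminate (inj₁ (z , A′z≈b′)) = inj₁ (z₀ ∷ z , λ i → trans (+-congˡ (A′z≈b′ i))
        (solve 3 (λ a z₀ b → a :* z₀ :+ (b :+ (:- z₀) :* a) := b) refl (A₀ i) z₀ (b i)))
      eliminate (inj₂ (y′ , y′A′≈0 , y′b′≉0)) = inj₂ (y″ , y″A≈0 , λ y″b≈0 → y′b′≉0 (trans y′b′≈y″b y″b≈0))
        where
        open ≈R
        t = α * ⟨ y′ , A₀ ⟩
        y″ = y′ ⊕ (- t) ∙ y

        y″A≈0 : ∀ j → ⟨ y″ , (λ i → A i j) ⟩ ≈ 0#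
        y″A≈0 zero = begin
          ⟨ y″ , A₀ ⟩                              ≈⟨ ⟨⟩-⊕ˡ y′ (- t) y A₀ ⟩
          ⟨ y′ , A₀ ⟩ + - t * ⟨ y , A₀ ⟩
            ≈⟨ solve 3 (λ p α q → p :+ (:- (α :* p)) :* q := p :- (q :* α) :* p) refl ⟨ y′ , A₀ ⟩ α ⟨ y , A₀ ⟩ ⟩
          ⟨ y′ , A₀ ⟩ - ⟨ y , A₀ ⟩ * α * ⟨ y′ , A₀ ⟩ ≈⟨ +-congˡ (-‿cong (trans (*-congʳ (*-recip yA₀≉0)) (*-identityˡ _))) ⟩
          ⟨ y′ , A₀ ⟩ - ⟨ y′ , A₀ ⟩                ≈⟨ -‿inverseʳ _ ⟩
          0# ∎
        y″A≈0 (suc j) = begin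
          ⟨ y″ , (λ i → A′ i j) ⟩                  ≈⟨ ⟨⟩-⊕ˡ y′ (- t) y _ ⟩
          ⟨ y′ , (λ i → A′ i j) ⟩ + - t * ⟨ y , (λ i → A′ i j) ⟩ ≈⟨ +-cong (y′A′≈0 j) (*-congˡ (yA′≈0 j)) ⟩
          0# + - t * 0#                            ≈⟨ trans (+-identityˡ _) (zeroʳ _) ⟩
          0# ∎

        y′b′≈y″b : ⟨ y′ , b′ ⟩ ≈ ⟨ y″ , b ⟩
        y′b′≈y″b = begin
          ⟨ y′ , b′ ⟩                              ≈⟨ ⟨⟩-⊕ʳ y′ b (- z₀) A₀ ⟩
          ⟨ y′ , b ⟩ + - z₀ * ⟨ y′ , A₀ ⟩
            ≈⟨ solve 4 (λ p α q r → p :+ (:- (α :* q)) :* r := p :+ (:- (α :* r)) :* q) refl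
                 ⟨ y′ , b ⟩ α ⟨ y , b ⟩ ⟨ y′ , A₀ ⟩ ⟩
          ⟨ y′ , b ⟩ + - t * ⟨ y , b ⟩             ≈⟨ ⟨⟩-⊕ˡ y′ (- t) y b ⟨
          ⟨ y″ , b ⟩                               ∎

    step : (Σ[ z ∈ Vec n ] (∀ i → ⟨ A′ i , z ⟩ ≈ b i)) ⊎
      (Σ[ y ∈ Vec m ] ((∀ j → ⟨ y , (λ i → A′ i j) ⟩ ≈ 0#) × ¬ (⟨ y , b ⟩ ≈ 0#))) →
      Solution ⊎ Obstruction
    step (inj₁ (z , A′z≈b)) = inj₁ (0# ∷ z , λ i →
      trans (+-cong (zeroʳ (A₀ i)) (A′z≈b i)) (+-identityˡ (b i)))
    step (inj₂ (y , yA′≈0 , yb≉0)) with ⟨ y , A₀ ⟩ ≟ 0#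
    ... | yes yA₀≈0 = inj₂ (y , yA≈0 , yb≉0)
      where
      yA≈0 : ∀ j → ⟨ y , (λ i → A i j) ⟩ ≈ 0#
      yA≈0 zero    = yA₀≈0
      yA≈0 (suc j) = yA′≈0 j
    ... | no yA₀≉0  = eliminate y yA′≈0 yA₀≉0 (fredholm A′ (b′ y yA′≈0 yA₀≉0))

  -- Weighted Laplacian of a nonnegative symmetric matrix

  module Laplacian {n} (M : Matrix n) (h : Vec n) (M-nonNeg : ∀ i j → 0# ≤ M i j) (M-sym : Symmetric M)
    (h-nonNeg : ∀ i → 0# ≤ h i) (h-pos : ∀ i → Supp M i → 0# < h i) where

    g : Vec n
    g i = recip (h i)

    D : Vec n
    D i = (M · h) i * g i

    D* : Vec n → Vec n
    D* x i = D i * x i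

    Mij-nonzero : ∀ {i j} → ¬ (M i j ≈ 0#) → Supp M i × Supp M j
    Mij-nonzero {i} {j} Mij≉0 = (j , Mij≉0) , (i , λ Mji≈0 → Mij≉0 (trans (M-sym i j) Mji≈0))

    row≈0 : ∀ {i} → ¬ Supp M i → ∀ x → (M · x) i ≈ 0#
    row≈0 {i} i∉ x = sum-zero λ j →
      trans (*-congʳ (decidable-stable (M i j ≟ 0#) (λ Mij≉0 → i∉ (j , Mij≉0)))) (zeroˡ (x j))

    Mh-nonNeg : ∀ i → 0# ≤ (M · h) i
    Mh-nonNeg i = sum-nonNeg λ j → *-nonNeg (M-nonNeg i j) (h-nonNeg j)

    Mh-pos : ∀ i → Supp M i → 0# < (M · h) i
    Mh-pos i (j , Mij≉0) = <-≤-trans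
      (*-pos (M-nonNeg i j , λ 0≈Mij → Mij≉0 (sym 0≈Mij)) (h-pos j (proj₂ (Mij-nonzero Mij≉0))))
      (term≤sum (λ j → *-nonNeg (M-nonNeg i j) (h-nonNeg j)) j)

    h*g≈1 : ∀ {i} → Supp M i → h i * g i ≈ 1#
    h*g≈1 {i} i∈ = *-recip (pos⇒≉0 (h-pos i i∈))

    D-nonNeg : ∀ i → 0# ≤ D i
    D-nonNeg i = *-nonNeg (Mh-nonNeg i) (recip-nonNeg (h-nonNeg i))

    D≈0 : ∀ {i} → ¬ Supp M i → D i ≈ 0#
    D≈0 i∉ = trans (*-congʳ (row≈0 i∉ h)) (zeroˡ _)

    M-h*g : ∀ i j {k} → (¬ (M i j ≈ 0#) → Supp M k) → M i j * (h k * g k) ≈ M i j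
    M-h*g i j supp with M i j ≟ 0#
    ... | yes Mij≈0 = trans (*-congʳ Mij≈0) (trans (zeroˡ _) (sym Mij≈0))
    ... | no  Mij≉0 = trans (*-congˡ (h*g≈1 (supp Mij≉0))) (*-identityʳ _)

    energyTerm : Vec n → Fin n → Fin n → Real
    energyTerm y i j = M i j * (h i * h j) * ((g i * y i - g j * y j) * (g i * y i - g j * y j))

    energy : Vec n → Real
    energy y = sum (λ i → sum (energyTerm y i))

    energyTerm-nonNeg : ∀ y i j → 0# ≤ energyTerm y i j
    energyTerm-nonNeg y i j =
      *-nonNeg (*-nonNeg (M-nonNeg i j) (*-nonNeg (h-nonNeg i) (h-nonNeg j))) (square-nonNeg _)

    energy-nonNeg : ∀ y → 0# ≤ energy y
    energy-nonNeg y = sum-nonNeg λ i → sum-nonNeg (energyTerm-nonNeg y i)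

    -- energy y = 2 (⟨ y , D* y ⟩ - ⟨ y , M y ⟩), with the subtraction moved to the other side.
    energy-identity : ∀ y →
      energy y + (⟨ y , M · y ⟩ + ⟨ y , M · y ⟩) ≈ ⟨ y , D* y ⟩ + ⟨ y , D* y ⟩
    energy-identity y = begin
      energy y + (⟨ y , M · y ⟩ + ⟨ y , M · y ⟩)
        ≈⟨ +-congˡ (+-cong ΣΣG ΣΣG) ⟨
      energy y + (ΣΣ G + ΣΣ G)
        ≈⟨ +-congˡ (ΣΣ-+ G G) ⟨
      energy y + ΣΣ (λ i j → G i j + G i j)
        ≈⟨ ΣΣ-+ (energyTerm y) _ ⟨
      ΣΣ (λ i j → energyTerm y i j + (G i j + G i j))
        ≈⟨ sum-cong-≋ (λ i → sum-cong-≋ (λ j → termwise i j)) ⟩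
      ΣΣ (λ i j → F i j + F j i)
        ≈⟨ ΣΣ-+ F (λ i j → F j i) ⟩
      ΣΣ F + ΣΣ (λ i j → F j i)
        ≈⟨ +-congˡ (∑-comm (λ i j → F j i)) ⟩
      ΣΣ F + ΣΣ F
        ≈⟨ +-cong ΣΣF ΣΣF ⟩
      ⟨ y , D* y ⟩ + ⟨ y , D* y ⟩ ∎
      where
      open ≈R
      ΣΣ : Matrix n → Real
      ΣΣ f = sum (λ i → sum (f i))

      ΣΣ-+ : ∀ f f′ → ΣΣ (λ i j → f i j + f′ i j) ≈ ΣΣ f + ΣΣ f′
      ΣΣ-+ f f′ = trans (sum-cong-≋ (λ i → ∑-distrib-+ (f i) (f′ i)))
        (∑-distrib-+ (λ i → sum (f i)) (λ i → sum (f′ i)))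

      F G : Matrix n
      F i j = M i j * h j * (g i * (y i * y i))
      G i j = y i * (M i j * y j)

      ΣΣG : ΣΣ G ≈ ⟨ y , M · y ⟩
      ΣΣG = sum-cong-≋ (λ i → sym (*-distribˡ-sum (y i) (λ j → M i j * y j)))

      ΣΣF : ΣΣ F ≈ ⟨ y , D* y ⟩
      ΣΣF = sum-cong-≋ (λ i → trans (sym (*-distribʳ-sum (g i * (y i * y i)) (λ j → M i j * h j)))
        (solve 3 (λ p g y → p :* (g :* (y :* y)) := y :* (p :* g :* y)) refl ((M · h) i) (g i) (y i)))

      termwise : ∀ i j → energyTerm y i j + (G i j + G i j) ≈ F i j + F j i
      termwise i j = begin
        energyTerm y i j + (G i j + G i j)
          ≈⟨ +-congˡ (+-cong G≈ G≈) ⟩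
        energyTerm y i j + (G′ + G′)
          ≈⟨ solve 7 (λ m hi hj gi gj yi yj →
               (m :* (hi :* hj)) :* ((gi :* yi :- gj :* yj) :* (gi :* yi :- gj :* yj)) :+
                 (yi :* (m :* (hi :* gi) :* (hj :* gj) :* yj) :+ yi :* (m :* (hi :* gi) :* (hj :* gj) :* yj)) :=
               (m :* (hi :* gi)) :* hj :* (gi :* (yi :* yi)) :+ (m :* (hj :* gj)) :* hi :* (gj :* (yj :* yj)))
             refl (M i j) (h i) (h j) (g i) (g j) (y i) (y j) ⟩
        M i j * (h i * g i) * h j * (g i * (y i * y i)) + M i j * (h j * g j) * h i * (g j * (y j * y j))
          ≈⟨ +-cong (*-congʳ (*-congʳ Mhg-i)) (*-congʳ (*-congʳ (trans Mhg-j (M-sym i j)))) ⟩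
        F i j + F j i ∎
        where
        Mhg-i : M i j * (h i * g i) ≈ M i j
        Mhg-i = M-h*g i j (proj₁ ∘ Mij-nonzero)
        Mhg-j : M i j * (h j * g j) ≈ M i j
        Mhg-j = M-h*g i j (proj₂ ∘ Mij-nonzero)
        G′ = y i * (M i j * (h i * g i) * (h j * g j) * y j)
        G≈ : G i j ≈ G′
        G≈ = *-congˡ (*-congʳ (sym (trans (*-congʳ Mhg-i) Mhg-j)))

    M≤D : ∀ y → ⟨ y , M · y ⟩ ≤ ⟨ y , D* y ⟩
    M≤D y = +-double-cancel-≤ (≤-respʳ (energy-identity y)
      (≤-respˡ (+-identityˡ _) (+-mono-≤ (energy-nonNeg y) ≤-refl)))

    kernel-locally-constant : ∀ y → ⟨ y , M · y ⟩ ≈ ⟨ y , D* y ⟩ →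
      ∀ {i j} → ¬ (M i j ≈ 0#) → g i * y i ≈ g j * y j
    kernel-locally-constant y M≈D {i} {j} Mij≉0 = begin
      g i * y i
        ≈⟨ solve 2 (λ p q → p := (p :- q) :+ q) refl (g i * y i) (g j * y j) ⟩
      (g i * y i - g j * y j) + g j * y j
        ≈⟨ +-congʳ (square≈0⇒≈0 (decidable-stable (_ ≟ 0#) λ sq≉0 → *-≉0 c≉0 sq≉0 term≈0)) ⟩
      0# + g j * y j
        ≈⟨ +-identityˡ _ ⟩
      g j * y j ∎
      where
      open ≈R
      energy≈0 : energy y ≈ 0#
      energy≈0 = begin
        energy y
          ≈⟨ solve 2 (λ e b → e := (e :+ (b :+ b)) :- (b :+ b)) refl (energy y) ⟨ y , M · y ⟩ ⟩
        energy y + (⟨ y , M · y ⟩ + ⟨ y , M · y ⟩) - (⟨ y , M · y ⟩ + ⟨ y , M · y ⟩)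
          ≈⟨ +-cong (energy-identity y) (-‿cong (+-cong M≈D M≈D)) ⟩
        ⟨ y , D* y ⟩ + ⟨ y , D* y ⟩ - (⟨ y , D* y ⟩ + ⟨ y , D* y ⟩)
          ≈⟨ -‿inverseʳ _ ⟩
        0# ∎
      term≈0 : energyTerm y i j ≈ 0#
      term≈0 = sum≈0⇒term≈0 (energyTerm-nonNeg y i)
        (sum≈0⇒term≈0 (λ i → sum-nonNeg (energyTerm-nonNeg y i)) energy≈0 i) j
      c≉0 : ¬ (M i j * (h i * h j) ≈ 0#)
      c≉0 = let (i∈ , j∈) = Mij-nonzero Mij≉0 in
        *-≉0 Mij≉0 (*-≉0 (pos⇒≉0 (h-pos i i∈)) (pos⇒≉0 (h-pos j j∈)))

    L : Matrix n
    L i j = D i * δ i j - M i j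

    L·≈ : ∀ x i → (L · x) i ≈ D i * x i - (M · x) i
    L·≈ x i = begin
      (L · x) i
        ≈⟨ solve 2 (λ l m → l := (l :+ m) :- m) refl ((L · x) i) ((M · x) i) ⟩
      (L · x) i + (M · x) i - (M · x) i
        ≈⟨ +-congʳ (∑-distrib-+ (λ j → L i j * x j) (λ j → M i j * x j)) ⟨
      sum (λ j → L i j * x j + M i j * x j) - (M · x) i
        ≈⟨ +-congʳ (sum-cong-≋ (λ j → solve 4 (λ d e m x → (d :* e :- m) :* x :+ m :* x := d :* (e :* x))
             refl (D i) (δ i j) (M i j) (x j))) ⟩
      sum (λ j → D i * (δ i j * x j)) - (M · x) i
        ≈⟨ +-congʳ (*-distribˡ-sum (D i) (λ j → δ i j * x j)) ⟨
      D i * ⟨ δ i , x ⟩ - (M · x) i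
        ≈⟨ +-congʳ (*-congˡ (⟨δ,⟩ i x)) ⟩
      D i * x i - (M · x) i ∎
      where open ≈R

    left-kernel⇒M≈D : ∀ y → (∀ j → ⟨ y , (λ i → L i j) ⟩ ≈ 0#) → ⟨ y , M · y ⟩ ≈ ⟨ y , D* y ⟩
    left-kernel⇒M≈D y yL≈0 = begin
      ⟨ y , M · y ⟩
        ≈⟨ ⟨⟩-congʳ y (λ i → trans
             (solve 2 (λ m d → m := d :+ :- con 1ℤ :* (d :- m)) refl ((M · y) i) (D i * y i))
             (+-congˡ (*-congˡ (sym (L·≈ y i))))) ⟩
      ⟨ y , D* y ⊕ (- 1#) ∙ L · y ⟩
        ≈⟨ ⟨⟩-⊕ʳ y (D* y) (- 1#) (L · y) ⟩
      ⟨ y , D* y ⟩ + - 1# * ⟨ y , L · y ⟩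
        ≈⟨ +-congˡ (*-congˡ (trans (⟨⟩-transpose y L y)
             (sum-zero (λ j → trans (*-congʳ (yL≈0 j)) (zeroˡ (y j)))))) ⟩
      ⟨ y , D* y ⟩ + - 1# * 0#
        ≈⟨ trans (+-congˡ (zeroʳ _)) (+-identityʳ _) ⟩
      ⟨ y , D* y ⟩ ∎
      where open ≈R

    module _
      (connected : ∀ (f : Vec n) → (∀ {i j} → ¬ (M i j ≈ 0#) → f i ≈ f j) →
        ∀ {i j} → Supp M i → Supp M j → f i ≈ f j)
      (contraction : ∀ z x → (∀ i → (M · z) i ≈ D* x i) → ⟨ z , M · z ⟩ ≤ ⟨ x , D* x ⟩)
      where

      constant-on-supp : ∀ (f : Vec n) → (∀ {i j} → ¬ (M i j ≈ 0#) → f i ≈ f j) →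
        Σ[ c ∈ Real ] (∀ {i} → Supp M i → f i ≈ c)
      constant-on-supp f loc with any? (supp? M)
      ... | yes (i₀ , i₀∈) = f i₀ , λ i∈ → connected f loc i∈ i₀∈
      ... | no none        = 0# , λ {i} i∈ → contradiction (i , i∈) none

      ⟂-of-constant : ∀ y u c → (∀ {i} → Supp M i → g i * y i ≈ c) → ⟨ u , M · h ⟩ ≈ 0# → ⟨ y , D* u ⟩ ≈ 0#
      ⟂-of-constant y u c gy≈c u⟂Mh = begin
        ⟨ y , D* u ⟩                      ≈⟨ sum-cong-≋ termwise ⟩
        sum (λ i → c * (u i * (M · h) i)) ≈⟨ *-distribˡ-sum c (λ i → u i * (M · h) i) ⟨
        c * ⟨ u , M · h ⟩                 ≈⟨ *-congˡ u⟂Mh ⟩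
        c * 0#                            ≈⟨ zeroʳ c ⟩
        0#                                ∎
        where
        open ≈R
        termwise : ∀ i → y i * D* u i ≈ c * (u i * (M · h) i)
        termwise i with supp? M i
        ... | yes i∈ = trans
          (solve 4 (λ y p g u → y :* (p :* g :* u) := (g :* y) :* (u :* p)) refl (y i) ((M · h) i) (g i) (u i))
          (*-congʳ (gy≈c i∈))
        ... | no i∉ = trans
          (trans (*-congˡ (trans (*-congʳ (D≈0 i∉)) (zeroˡ _))) (zeroʳ _))
          (sym (trans (*-congˡ (trans (*-congˡ (row≈0 i∉ h)) (zeroʳ _))) (zeroʳ _)))

      kernel-⟂ : ∀ y u → (∀ j → ⟨ y , (λ i → L i j) ⟩ ≈ 0#) → ⟨ u , M · h ⟩ ≈ 0# → ⟨ y , D* u ⟩ ≈ 0#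
      kernel-⟂ y u yL≈0 =
        let (c , gy≈c) = constant-on-supp (λ i → g i * y i) (kernel-locally-constant y (left-kernel⇒M≈D y yL≈0))
        in ⟂-of-constant y u c gy≈c

      -- With L z = D u and x = z - u one has M z = D x, so the contraction
      -- hypothesis gives ⟨ z , D x ⟩ ≤ ⟨ x , D x ⟩, that is ⟨ u , D x ⟩ ≤ 0, and
      -- ⟨ x , M x ⟩ ≤ ⟨ x , D x ⟩ becomes ⟨ u , M u ⟩ ≤ ⟨ u , D x ⟩.
      nonPos-of-solution : ∀ u z → (∀ i → (L · z) i ≈ D* u i) → ⟨ u , M · u ⟩ ≤ 0#
      nonPos-of-solution u z Lz≈Du = ≤-trans uMu≤uDx uDx≤0
        where
        open ≤R
        x = z ⊕ (- 1#) ∙ u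

        Mz≈Dx : ∀ i → (M · z) i ≈ D* x i
        Mz≈Dx i = begin-equality
          (M · z) i
            ≈⟨ solve 2 (λ m d → m := d :- (d :- m)) refl ((M · z) i) (D i * z i) ⟩
          D i * z i - (D i * z i - (M · z) i)
            ≈⟨ +-congˡ (-‿cong (trans (sym (L·≈ z i)) (Lz≈Du i))) ⟩
          D i * z i - D i * u i
            ≈⟨ solve 3 (λ d z u → d :* z :- d :* u := d :* (z :+ :- con 1ℤ :* u)) refl (D i) (z i) (u i) ⟩
          D* x i ∎

        Q = ⟨ x , D* x ⟩
        R = ⟨ u , D* x ⟩

        zMz≈ : ⟨ z , M · z ⟩ ≈ Q + R
        zMz≈ = begin-equality
          ⟨ z , M · z ⟩ ≈⟨ ⟨⟩-congʳ z Mz≈Dx ⟩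
          ⟨ z , D* x ⟩
            ≈⟨ solve 2 (λ a b → a := (a :+ :- con 1ℤ :* b) :+ b) refl ⟨ z , D* x ⟩ R ⟩
          ⟨ z , D* x ⟩ + - 1# * R + R ≈⟨ +-congʳ (⟨⟩-⊕ˡ z (- 1#) u (D* x)) ⟨
          Q + R ∎

        uDx≤0 : R ≤ 0#
        uDx≤0 = +-cancelˡ-≤ Q (begin
          Q + R         ≈⟨ zMz≈ ⟨
          ⟨ z , M · z ⟩ ≤⟨ contraction z x Mz≈Dx ⟩
          Q             ≈⟨ +-identityʳ Q ⟨
          Q + 0#        ∎)

        xMx≈ : ⟨ x , M · x ⟩ ≈ (Q - R) + ⟨ u , M · u ⟩
        xMx≈ = begin-equality
          ⟨ x , M · x ⟩
            ≈⟨ quadratic-⊕ M-sym z (- 1#) u ⟩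
          ⟨ z , M · z ⟩ + (- 1# * ⟨ z , M · u ⟩ + - 1# * ⟨ z , M · u ⟩) + - 1# * - 1# * ⟨ u , M · u ⟩
            ≈⟨ +-congʳ (+-cong zMz≈ (+-cong (*-congˡ zMu≈R) (*-congˡ zMu≈R))) ⟩
          Q + R + (- 1# * R + - 1# * R) + - 1# * - 1# * ⟨ u , M · u ⟩
            ≈⟨ solve 3 (λ q r b → q :+ r :+ (:- con 1ℤ :* r :+ :- con 1ℤ :* r) :+
                 :- con 1ℤ :* :- con 1ℤ :* b := (q :- r) :+ b) refl Q R ⟨ u , M · u ⟩ ⟩
          (Q - R) + ⟨ u , M · u ⟩ ∎
          where
          zMu≈R : ⟨ z , M · u ⟩ ≈ R
          zMu≈R = trans (form-sym M-sym z u) (⟨⟩-congʳ u Mz≈Dx)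

        uMu≤uDx : ⟨ u , M · u ⟩ ≤ R
        uMu≤uDx = +-cancelˡ-≤ (Q - R) (begin
          (Q - R) + ⟨ u , M · u ⟩ ≈⟨ xMx≈ ⟨
          ⟨ x , M · x ⟩           ≤⟨ M≤D x ⟩
          Q                       ≈⟨ solve 2 (λ q r → q := (q :- r) :+ r) refl Q R ⟩
          (Q - R) + R             ∎)

      nonPos-on-⟂ : ∀ u → ⟨ u , M · h ⟩ ≈ 0# → ⟨ u , M · u ⟩ ≤ 0#
      nonPos-on-⟂ u u⟂Mh with fredholm L (D* u)
      ... | inj₁ (z , Lz≈Du)        = nonPos-of-solution u z Lz≈Du
      ... | inj₂ (y , yL≈0 , yDu≉0) = contradiction (kernel-⟂ y u yL≈0 u⟂Mh) yDu≉0

  nonPos-on-hyperplane⇒hyperbolic : ∀ {n} {M : Matrix n} → Symmetric M → ∀ h →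
    (∀ u → ⟨ u , M · h ⟩ ≈ 0# → ⟨ u , M · u ⟩ ≤ 0#) → HyperbolicMatrix M
  nonPos-on-hyperplane⇒hyperbolic {M = M} M-sym h nonPos x y 0<Y = 0≤y-x⇒x≤y 0≤gap
    where
    a = ⟨ y , M · h ⟩
    b = ⟨ x , M · h ⟩
    X = ⟨ x , M · x ⟩
    P = ⟨ x , M · y ⟩
    Y = ⟨ y , M · y ⟩

    a≉0 : ¬ (a ≈ 0#)
    a≉0 a≈0 = proj₂ 0<Y (antisym (proj₁ 0<Y) (nonPos y a≈0))

    c = - (b * recip a)
    u = x ⊕ c ∙ y

    ca≈-b : c * a ≈ - b
    ca≈-b = trans (solve 3 (λ b r a → :- (b :* r) :* a := :- (b :* (a :* r))) refl b (recip a) a)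
      (-‿cong (trans (*-congˡ (*-recip a≉0)) (*-identityʳ b)))

    u⟂Mh : ⟨ u , M · h ⟩ ≈ 0#
    u⟂Mh = trans (⟨⟩-⊕ˡ x c y (M · h)) (trans (+-congˡ ca≈-b) (-‿inverseʳ b))

    uMu = X + (c * P + c * P) + c * c * Y

    uMu≤0 : uMu ≤ 0#
    uMu≤0 = ≤-respˡ (quadratic-⊕ M-sym x c y) (nonPos u u⟂Mh)

    -- P² - XY = (P + cY)² - Y (X + 2cP + c²Y)
    0≤gap : 0# ≤ P * P - X * Y
    0≤gap = ≤-respʳ
      (solve 4 (λ X P Y c →
        (P :+ c :* Y) :* (P :+ c :* Y) :+ Y :* (con 0ℤ :- (X :+ (c :* P :+ c :* P) :+ c :* c :* Y)) :=
        P :* P :- X :* Y) refl X P Y c)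
      (≤-respˡ (+-identityˡ 0#) (+-mono-≤ (square-nonNeg _)
        (*-nonNeg (proj₁ 0<Y) (x≤y⇒0≤y-x uMu≤0))))

  irreducible⇒connected : ∀ {n} {M : Matrix n} → Symmetric M → Irreducible (restrictToSupp M) →
    ∀ (f : Vec n) → (∀ {i j} → ¬ (M i j ≈ 0#) → f i ≈ f j) → ∀ {i j} → Supp M i → Supp M j → f i ≈ f j
  irreducible⇒connected {n} {M} M-sym irr f loc {p} {q} p∈ q∈ = decidable-stable (f p ≟ f q) λ fp≉fq →
    irr (π , 2 , s≤s (s≤s z≤n) , record
      { block      = colour ∘ vertex ∘ (π ⟨$⟩ʳ_)
      ; monotone   = proj₂ sorted
      ; surjective = surjective fp≉fq
      ; zeroBelow  = λ {i} {j} → colour-zero (vertex (π ⟨$⟩ʳ i)) (vertex (π ⟨$⟩ʳ j))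
      })
    where
    colour : Fin n → Fin 2
    colour k = if does (f k ≟ f p) then 0F else 1F

    colour-≈ : ∀ {k} → f k ≈ f p → colour k ≡ 0F
    colour-≈ {k} fk≈fp with f k ≟ f p
    ... | yes _    = ≡.refl
    ... | no fk≉fp = contradiction fk≈fp fk≉fp

    colour-≉ : ∀ {k} → ¬ (f k ≈ f p) → colour k ≡ 1F
    colour-≉ {k} fk≉fp with f k ≟ f p
    ... | yes fk≈fp = contradiction fk≈fp fk≉fp
    ... | no _      = ≡.refl

    colour-zero : ∀ k l → colour l <ᶠ colour k → M k l ≈ 0#
    colour-zero k l l<k = decidable-stable (M k l ≟ 0#) λ Mkl≉0 → ℕ.<-irrefl (≡.cong toℕ (same (loc Mkl≉0))) l<k
      where
      same : f k ≈ f l → colour l ≡ colour k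
      same fk≈fl with f k ≟ f p
      ... | yes fk≈fp = colour-≈ (trans (sym fk≈fl) fk≈fp)
      ... | no fk≉fp  = colour-≉ (λ fl≈fp → fk≉fp (trans fk≈fl fl≈fp))

    vertex : Fin (length (suppList M)) → Fin n
    vertex = lookup (suppList M)

    sorted = sorting-permutation (colour ∘ vertex)
    π = proj₁ sorted

    module _ {k} (k∈ : Supp M k) where

      position = ∈-filter⁺ (supp? M) (∈-allFin k) k∈

      preimage : Fin (length (suppList M))
      preimage = π ⟨$⟩ˡ index position

      vertex-preimage : vertex (π ⟨$⟩ʳ preimage) ≡ k
      vertex-preimage = ≡.trans (≡.cong vertex (inverseʳ π)) (≡.sym (lookup-index position))

    surjective : ¬ (f p ≈ f q) → ∀ b → ∃[ k ] colour (vertex (π ⟨$⟩ʳ k)) ≡ b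
    surjective fp≉fq 0F = preimage p∈ , ≡.trans (≡.cong colour (vertex-preimage p∈)) (colour-≈ refl)
    surjective fp≉fq 1F = preimage q∈ ,
      ≡.trans (≡.cong colour (vertex-preimage q∈)) (colour-≉ (λ fq≈fp → fp≉fq (sym fq≈fp)))

  module _ {d : ℕ} {a r : Level} (𝔸 : Atlas d a r) where

    open Atlas 𝔸

    module _ (inh : Inheritance) (pull : Pullback) (v : Ω) (v⁺ : NonSink _≺_ v) (reg : Regular v)
      (hyp : ∀ w → Edge _≺_ v w → Hyperbolic w) where

      open Laplacian (M v) (h v) (M-nonNeg v) (M-symmetric v) (h-nonNeg v) (proj₂ reg)

      pulled : Vec d → Fin d → Real
      pulled z i = ⟨ T v v⁺ i z , M (next v v⁺ i) · T v v⁺ i z ⟩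

      neighbour-bound : ∀ z i → Supp (M v) i → pulled z i * (M v · h v) i ≤ (M v · z) i * (M v · z) i
      neighbour-bound z i i∈ = ≤-respˡ (*-congˡ (sym (Inh (h v)))) (≤-respʳ (*-cong (sym (Inh z)) (sym (Inh z)))
        (hyp (next v v⁺ i) (next-edge v v⁺ i) (T v v⁺ i z) (T v v⁺ i (h v)) (<-respʳ (Inh (h v)) (Mh-pos i i∈))))
        where
        Inh = inh v v⁺ i i∈

      contraction : ∀ z x → (∀ i → (M v · z) i ≈ D* x i) → ⟨ z , M v · z ⟩ ≤ ⟨ x , D* x ⟩
      contraction z x Mz≈Dx = ≤-trans (pull v v⁺ z) (sum-mono-≤ termwise)
        where
        termwise : ∀ i → (if does (supp? (M v) i) then h v i * pulled z i else 0#) ≤ x i * D* x i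
        termwise i with supp? (M v) i
        ... | no _   = ≤-respʳ (solve 2 (λ d x → d :* (x :* x) := x :* (d :* x)) refl (D i) (x i))
                         (*-nonNeg (D-nonNeg i) (square-nonNeg (x i)))
        ... | yes i∈ = *-cancelˡ-≤ (Mh-pos i i∈) (begin
          p * (h v i * A)                ≈⟨ solve 3 (λ p h a → p :* (h :* a) := h :* (a :* p)) refl p (h v i) A ⟩
          h v i * (A * p)                ≤⟨ *-monoʳ-≤ (h-nonNeg v i) (neighbour-bound z i i∈) ⟩
          h v i * ((M v · z) i * (M v · z) i) ≈⟨ *-congˡ (*-cong (Mz≈Dx i) (Mz≈Dx i)) ⟩
          h v i * (D* x i * D* x i)
            ≈⟨ solve 4 (λ h p g x → h :* ((p :* g :* x) :* (p :* g :* x)) :=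
                 (h :* g) :* (p :* (x :* (p :* g :* x)))) refl (h v i) p (g i) (x i) ⟩
          h v i * g i * (p * (x i * D* x i)) ≈⟨ *-congʳ (h*g≈1 i∈) ⟩
          1# * (p * (x i * D* x i))      ≈⟨ *-identityˡ _ ⟩
          p * (x i * D* x i)             ∎)
          where
          open ≤R
          p = (M v · h v) i
          A = pulled z i

      hyperbolic : Hyperbolic v
      hyperbolic = nonPos-on-hyperplane⇒hyperbolic (M-symmetric v) (h v)
        (nonPos-on-⟂ (irreducible⇒connected (M-symmetric v) (proj₁ reg)) contraction)

theorem5p2 : (ℝ : RealNumbers) → let open CombinatorialAtlas ℝ in
    {a r : Level} (d : ℕ) (𝔸 : Atlas d a r) → let open Atlas 𝔸 in
    Inheritance → Pullback →
    (v : Ω) → NonSink _≺_ v → Regular v →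
    (∀ w → Edge _≺_ v w → Hyperbolic w) →
    Hyperbolic v
theorem5p2 ℝ d 𝔸 = hyperbolic ℝ 𝔸
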